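{- Let $r\ge 3$ and $k\ge 3$ be integers and let $G$ be an $r$-uniform hypergraph on $n$ vertices that is $\mathcal{G}_k^{(r)}$-free. Let $F\in\mathcal{M}_2$ with $|F|\ge k+1$. Then $|F|\ge 2m(F)-k+3$.
   Context: An $r$-graph is identified with its edge set; $|H|$ is its number of edges and $V(H)=\bigcup_{e\in H}e$. The family $\mathcal{G}_k^{(r)}$ consists of all $r$-graphs $H$ such that either $|H|=k$ and $|V(H)|\le (r-2)k+2$, or $|H|=\ell$ and $|V(H)|\le (r-2)\ell+1$ for some $\ell\in\{2,\dots,k-1\}$; $G$ is $\mathcal{G}_k^{(r)}$-free if no subset of its edges forms a member of this family. For $F\subseteq G$ and distinct vertices $x,y$, let $C_F(xy)$ be the set of integers $i\ge 0$ for which there exist $i$ distinct edges $e_1,\dots,e_i\in F$ with $|\{x,y\}\cup e_1\cup\dots\cup e_i|\le (r-2)i+2$. An $r$-graph $F$ is connected if for any edges $X,Y\in F$ there are edges $X=X_1,\dots,X_m=Y$ of $F$ with $|X_i\cap X_{i+1}|\ge 2$ for all $i$. $\mathcal{M}_1$ is the partition of $E(G)$ into maximal connected subgraphs (1-clusters). Edge-disjoint $F,H\subseteq G$ are $1|2$-mergeable if there is a pair $xy$ with $1\in C_F(xy)$ and $2\in C_H(xy)$, or with $2\in C_F(xy)$ and $1\in C_H(xy)$. $\mathcal{M}_2$ is a partition of $E(G)$ obtained from $\mathcal{M}_1$ by repeatedly replacing two distinct $1|2$-mergeable parts by their union as long as possible. For $F\in\mathcal{M}_2$, the merging number $m(F)$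 is the number of 1-clusters (elements of $\mathcal{M}_1$) contained in $F$. -}

module Defs where

open import Data.Nat using (ℕ; _+_; _*_; _∸_; _≤_)
open import Data.Fin using (Fin)
open import Data.Fin.Subset using (Subset; _∈_; _∉_; _⊆_; _∩_; _∪_; ⋃; ⁅_⁆; ∣_∣; ⊥; Nonempty)
open import Data.Fin.Subset.Properties using (_∈?_; _⊆?_)
open import Data.List using (List; []; _∷_; map; filter; length; allFin)
open import Data.List.Membership.Propositional using () renaming (_∈_ to _∈L_)
open import Data.List.Relation.Unary.AllPairs using (AllPairs)
open import Data.List.Relation.Binary.Permutation.Propositional using (_↭_)
open import Relation.Binary.Construct.Closure.ReflexiveTransitive using (Star)
open import Relation.Binary.PropositionalEquality using (_≡_; _≢_)
open import Data.Product using (Σ; _×_; ∃; ∃-syntax)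
open import Data.Sum using (_⊎_)
open import Relation.Nullary using (¬_)
open import Function.Definitions using (Injective)

-- An r-graph on vertex set Fin n with m edges: edge i is the vertex set G i.
-- Sub-hypergraphs (edge subsets) of G are Subset m.

IsRGraph : ∀ {n m} → ℕ → (Fin m → Subset n) → Set
IsRGraph {n} {m} r G = Injective _≡_ _≡_ G × (∀ i → ∣ G i ∣ ≡ r)

V : ∀ {n m} → (Fin m → Subset n) → Subset m → Subset n
V {m = m} G S = ⋃ (map G (filter (_∈? S) (allFin m)))

GkFree : ∀ {n m} → ℕ → ℕ → (Fin m → Subset n) → Set
GkFree {n} {m} r k G = (S : Subset m) → ¬ (
    (∣ S ∣ ≡ k × ∣ V G S ∣ ≤ (r ∸ 2) * k + 2)
  ⊎ (2 ≤ ∣ S ∣ × ∣ S ∣ + 1 ≤ k × ∣ V G S ∣ ≤ (r ∸ 2) * ∣ S ∣ + 1))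

InC : ∀ {n m} → ℕ → (Fin m → Subset n) → Subset m → Fin n → Fin n → ℕ → Set
InC {n} {m} r G F x y i = Σ (Subset m) λ S →
  S ⊆ F × ∣ S ∣ ≡ i × ∣ (⁅ x ⁆ ∪ ⁅ y ⁆) ∪ V G S ∣ ≤ (r ∸ 2) * i + 2

Mergeable : ∀ {n m} → ℕ → (Fin m → Subset n) → Subset m → Subset m → Set
Mergeable {n} r G F H = ∃[ x ] ∃[ y ] (x ≢ y ×
  ((InC r G F x y 1 × InC r G H x y 2) ⊎ (InC r G F x y 2 × InC r G H x y 1)))

data Walk {n m} (G : Fin m → Subset n) (F : Subset m) : Fin m → Fin m → Set where
  here : ∀ {X} → X ∈ F → Walk G F X X
  step : ∀ {X Z Y} → X ∈ F → 2 ≤ ∣ G X ∩ G Z ∣ → Walk G F Z Y → Walk G F X Y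

Connected : ∀ {n m} → (Fin m → Subset n) → Subset m → Set
Connected G F = ∀ X Y → X ∈ F → Y ∈ F → Walk G F X Y

IsPartition : ∀ {m} → List (Subset m) → Set
IsPartition {m} P =
  (∀ A → A ∈L P → Nonempty A)
  × AllPairs (λ A B → A ∩ B ≡ ⊥) P
  × (∀ (i : Fin m) → ∃[ A ] (A ∈L P × i ∈ A))

IsM1 : ∀ {n m} → (Fin m → Subset n) → List (Subset m) → Set
IsM1 {n} {m} G P1 = IsPartition P1 ×
  (∀ A → A ∈L P1 → Connected G A × (∀ (H : Subset m) → A ⊆ H → Connected G H → H ⊆ A))

data MergeStep {n m} (r : ℕ) (G : Fin m → Subset n) : List (Subset m) → List (Subset m) → Set where
  merge : ∀ {P} A B Q → P ↭ (A ∷ B ∷ Q) → Mergeable r G A B → MergeStep r G P ((A ∪ B) ∷ Q)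

IsM2 : ∀ {n m} → ℕ → (Fin m → Subset n) → List (Subset m) → List (Subset m) → Set
IsM2 {n} {m} r G P1 P = Star (MergeStep r G) P1 P ×
  (∀ A B Q → P ↭ (A ∷ B ∷ Q) → ¬ Mergeable r G A B)

mnum : ∀ {m} → List (Subset m) → Subset m → ℕ
mnum P1 F = length (filter (_⊆? F) P1)

{-# OPTIONS --safe #-}
module Submission where

-- Write d = r - 2 and call S good if |V(S)| ≤ d|S| + 2, so no good set has size k.
-- From a good nonempty proper subset of a part F one can always pass to a larger good
-- subset of F by adding one edge (inside a 1-cluster, or across a merging pair) or two
-- edges (across a merging pair in the other direction).  F is a tree of 1-clusters; split
-- off a leaf L.  If L is a single edge, then its merging pair xy is covered by two edges of
-- F \ L; growing from these two inside F \ L reaches size k - 1, and adding L gives a good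
-- set of size k, a contradiction.  If |L| ≥ 2, then induct on F \ L, or, when
-- |F \ L| < k, use that a tree with at least two edges has fewer clusters than edges.

open import Defs
open import Data.Nat using (ℕ; zero; suc; _+_; _*_; _∸_; _≤_; _<_; z≤n; s≤s; _≟_)
open import Data.Nat.Properties
open import Data.Nat.Solver using (module +-*-Solver)
open import Data.Fin using (Fin)
open import Data.Fin.Subset using (Subset; inside; outside; _∈_; _∉_; _⊆_; _∩_; _∪_; ∁; ⋃; ⁅_⁆; ∣_∣; ⊥; Nonempty)
open import Data.Fin.Subset.Properties
open import Data.Vec.Base using ([]; _∷_)
open import Data.List using (List; []; _∷_; length; allFin)
open import Data.List.Membership.Propositional using () renaming (_∈_ to _∈L_)
open import Data.List.Membership.Propositional.Properties using (∈-map⁺; ∈-map⁻; ∈-filter⁺; ∈-filter⁻; ∈-allFin)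
open import Data.List.Relation.Unary.Any using (here; there)
open import Data.List.Relation.Unary.All as All using (All; []; _∷_)
open import Data.List.Relation.Unary.AllPairs as AllPairs using (AllPairs; []; _∷_)
import Data.List.Relation.Unary.AllPairs.Properties as AllPairs
open import Data.List.Relation.Binary.Permutation.Propositional using (↭⇒↭ₛ)
open import Data.List.Relation.Binary.Permutation.Propositional.Properties using (All-resp-↭)
open import Data.List.Relation.Binary.Permutation.Setoid.Properties using (AllPairs-resp-↭)
open import Data.Product using (_×_; _,_; ∃-syntax; proj₁; proj₂)
open import Data.Sum using (_⊎_; inj₁; inj₂; [_,_]′)
open import Data.Empty using (⊥-elim)
open import Function using (_∘_)
open import Relation.Binary.Construct.Closure.ReflexiveTransitive using (Star; ε; _◅_)
open import Relation.Binary.Definitions using (Tri; tri<; tri≈; tri>)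
open import Relation.Nullary using (¬_; yes; no)
open import Relation.Binary.PropositionalEquality as ≡ using (_≡_; _≢_; refl; sym; trans; cong; cong₂; subst; subst₂)

-- Finite sets and their cardinalities.

Disjoint : ∀ {n} → Subset n → Subset n → Set
Disjoint p q = ∀ {x} → x ∈ p → x ∉ q

disjoint-sym : ∀ {n} {p q : Subset n} → Disjoint p q → Disjoint q p
disjoint-sym p∥q x∈q x∈p = p∥q x∈p x∈q

disjoint⇒∩≡⊥ : ∀ {n} {p q : Subset n} → Disjoint p q → p ∩ q ≡ ⊥
disjoint⇒∩≡⊥ {p = p} {q} p∥q = Empty-unique λ (x , x∈) →
  let x∈p , x∈q = x∈p∩q⁻ p q x∈ in p∥q x∈p x∈q

∩≡⊥⇒disjoint : ∀ {n} {p q : Subset n} → p ∩ q ≡ ⊥ → Disjoint p q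
∩≡⊥⇒disjoint eq x∈p x∈q = ∉⊥ (subst (_ ∈_) eq (x∈p∩q⁺ (x∈p , x∈q)))

∪-lub : ∀ {n} {p q s : Subset n} → p ⊆ s → q ⊆ s → p ∪ q ⊆ s
∪-lub {p = p} {q} p⊆s q⊆s x∈ = [ p⊆s , q⊆s ]′ (x∈p∪q⁻ p q x∈)

∣p∪q∣+∣p∩q∣≡∣p∣+∣q∣ : ∀ {n} (p q : Subset n) → ∣ p ∪ q ∣ + ∣ p ∩ q ∣ ≡ ∣ p ∣ + ∣ q ∣
∣p∪q∣+∣p∩q∣≡∣p∣+∣q∣ []            []            = refl
∣p∪q∣+∣p∩q∣≡∣p∣+∣q∣ (outside ∷ p) (outside ∷ q) = ∣p∪q∣+∣p∩q∣≡∣p∣+∣q∣ p q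
∣p∪q∣+∣p∩q∣≡∣p∣+∣q∣ (inside  ∷ p) (outside ∷ q) = cong suc (∣p∪q∣+∣p∩q∣≡∣p∣+∣q∣ p q)
∣p∪q∣+∣p∩q∣≡∣p∣+∣q∣ (outside ∷ p) (inside  ∷ q) =
  trans (cong suc (∣p∪q∣+∣p∩q∣≡∣p∣+∣q∣ p q)) (sym (+-suc ∣ p ∣ ∣ q ∣))
∣p∪q∣+∣p∩q∣≡∣p∣+∣q∣ (inside  ∷ p) (inside  ∷ q) =
  cong suc (trans (+-suc _ _) (trans (cong suc (∣p∪q∣+∣p∩q∣≡∣p∣+∣q∣ p q)) (sym (+-suc ∣ p ∣ ∣ q ∣))))

disjoint⇒∣p∪q∣≡∣p∣+∣q∣ : ∀ {n} {p q : Subset n} → Disjoint p q → ∣ p ∪ q ∣ ≡ ∣ p ∣ + ∣ q ∣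
disjoint⇒∣p∪q∣≡∣p∣+∣q∣ {n} {p} {q} p∥q = begin
  ∣ p ∪ q ∣               ≡⟨ +-identityʳ _ ⟨
  ∣ p ∪ q ∣ + 0           ≡⟨ cong (∣ p ∪ q ∣ +_) (trans (cong ∣_∣ (disjoint⇒∩≡⊥ p∥q)) (∣⊥∣≡0 n)) ⟨
  ∣ p ∪ q ∣ + ∣ p ∩ q ∣   ≡⟨ ∣p∪q∣+∣p∩q∣≡∣p∣+∣q∣ p q ⟩
  ∣ p ∣ + ∣ q ∣           ∎
  where open ≡.≡-Reasoning

∣p∣≥1⇒nonempty : ∀ {n} (p : Subset n) → 1 ≤ ∣ p ∣ → Nonempty p
∣p∣≥1⇒nonempty {n} p 1≤ with nonempty? p
... | yes ne = ne
... | no  em = ⊥-elim (1+n≰n (subst (1 ≤_) (trans (cong ∣_∣ (Empty-unique em)) (∣⊥∣≡0 n)) 1≤))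

nonempty⇒∣p∣≥1 : ∀ {n} {p : Subset n} → Nonempty p → 1 ≤ ∣ p ∣
nonempty⇒∣p∣≥1 {p = p} (x , x∈p) = subst (_≤ ∣ p ∣) (∣⁅x⁆∣≡1 x)
  (p⊆q⇒∣p∣≤∣q∣ λ y∈ → subst (_∈ p) (sym (x∈⁅y⁆⇒x≡y x y∈)) x∈p)

⊈⇒∃∉ : ∀ {n} {p q : Subset n} → ¬ (p ⊆ q) → ∃[ x ] (x ∈ p × x ∉ q)
⊈⇒∃∉ {p = p} {q} p⊈q with nonempty? (p ∩ ∁ q)
... | yes (x , x∈) = let x∈p , x∈∁q = x∈p∩q⁻ p (∁ q) x∈ in x , x∈p , x∈∁p⇒x∉p x∈∁q
... | no  em = ⊥-elim (p⊈q λ x∈p → x∉∁p⇒x∈p λ x∈∁q → em (_ , x∈p∩q⁺ (x∈p , x∈∁q)))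

∣q∣<∣p∣⇒∃∉ : ∀ {n} {p q : Subset n} → ∣ q ∣ < ∣ p ∣ → ∃[ x ] (x ∈ p × x ∉ q)
∣q∣<∣p∣⇒∃∉ q<p = ⊈⇒∃∉ λ p⊆q → <⇒≱ q<p (p⊆q⇒∣p∣≤∣q∣ p⊆q)

∣q∪p∣≤∣p∣⇒q⊆p : ∀ {n} {p q : Subset n} → ∣ q ∪ p ∣ ≤ ∣ p ∣ → q ⊆ p
∣q∪p∣≤∣p∣⇒q⊆p {p = p} {q} le {x} x∈q with x ∈? p
... | yes x∈p = x∈p
... | no  x∉p = ⊥-elim (<⇒≱ (p⊂q⇒∣p∣<∣q∣ {p = p} (q⊆p∪q q p , x , p⊆p∪q p x∈q , x∉p)) le)

x≢y⇒∣⁅x⁆∪⁅y⁆∣≡2 : ∀ {n} {x y : Fin n} → x ≢ y → ∣ ⁅ x ⁆ ∪ ⁅ y ⁆ ∣ ≡ 2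
x≢y⇒∣⁅x⁆∪⁅y⁆∣≡2 {x = x} {y} x≢y = trans
  (disjoint⇒∣p∪q∣≡∣p∣+∣q∣ λ z∈x z∈y → x≢y (trans (sym (x∈⁅y⁆⇒x≡y x z∈x)) (x∈⁅y⁆⇒x≡y y z∈y)))
  (cong₂ _+_ (∣⁅x⁆∣≡1 x) (∣⁅x⁆∣≡1 y))

∈⋃⁺ : ∀ {n} {p : Subset n} {ps x} → p ∈L ps → x ∈ p → x ∈ ⋃ ps
∈⋃⁺ (here refl) x∈p = p⊆p∪q _ x∈p
∈⋃⁺ {ps = q ∷ _} (there p∈) x∈p = q⊆p∪q q _ (∈⋃⁺ p∈ x∈p)

∈⋃⁻ : ∀ {n} (ps : List (Subset n)) {x} → x ∈ ⋃ ps → ∃[ p ] (p ∈L ps × x ∈ p)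
∈⋃⁻ []       x∈ = ⊥-elim (∉⊥ x∈)
∈⋃⁻ (p ∷ ps) x∈ with x∈p∪q⁻ p (⋃ ps) x∈
... | inj₁ x∈p = p , here refl , x∈p
... | inj₂ x∈⋃ = let q , q∈ , x∈q = ∈⋃⁻ ps x∈⋃ in q , there q∈ , x∈q

-- Vertex sets and walks.

module _ {n m : ℕ} {G : Fin m → Subset n} where

  G⊆V : ∀ {S i} → i ∈ S → G i ⊆ V G S
  G⊆V {S} {i} i∈S = ∈⋃⁺ (∈-map⁺ G (∈-filter⁺ (_∈? S) (∈-allFin i) i∈S))

  V⊆ : ∀ S {W} → (∀ {i} → i ∈ S → G i ⊆ W) → V G S ⊆ W
  V⊆ S below x∈V with ∈⋃⁻ _ x∈V
  ... | _ , p∈ , x∈p with ∈-map⁻ G p∈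
  ... | i , i∈ , refl = below (proj₂ (∈-filter⁻ (_∈? S) {xs = allFin m} i∈)) x∈p

  V-∪ : ∀ S D → V G (S ∪ D) ⊆ V G S ∪ V G D
  V-∪ S D = V⊆ (S ∪ D) λ i∈ x∈ → x∈p∪q⁺ ([ (λ i∈S → inj₁ (G⊆V i∈S x∈)) , (λ i∈D → inj₂ (G⊆V i∈D x∈)) ]′ (x∈p∪q⁻ S D i∈))

  walk-start : ∀ {A X Y} → Walk G A X Y → X ∈ A
  walk-start (here X∈A)     = X∈A
  walk-start (step X∈A _ _) = X∈A

  walk-mono : ∀ {A B X Y} → A ⊆ B → Walk G A X Y → Walk G B X Y
  walk-mono A⊆B (here X∈A)       = here (A⊆B X∈A)
  walk-mono A⊆B (step X∈A adj w) = step (A⊆B X∈A) adj (walk-mono A⊆B w)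

  walk-snoc : ∀ {A X Y Z} → Walk G A X Y → 2 ≤ ∣ G Y ∩ G Z ∣ → Z ∈ A → Walk G A X Z
  walk-snoc (here X∈A)       adj Z∈A = step X∈A adj (here Z∈A)
  walk-snoc (step X∈A adj′ w) adj Z∈A = step X∈A adj′ (walk-snoc w adj Z∈A)

-- Edge sets closed under adjacency, and trees of merges.

Closed : ∀ {n m} → (Fin m → Subset n) → Subset m → Set
Closed G A = ∀ {i j} → i ∈ A → 2 ≤ ∣ G i ∩ G j ∣ → j ∈ A

module _ {n m : ℕ} {G : Fin m → Subset n} where

  -- Unlike connectedness, closedness survives unions; this is how merged parts inherit it from
  -- their 1-clusters.
  closed-∪ : ∀ {A B} → Closed G A → Closed G B → Closed G (A ∪ B)
  closed-∪ {A} {B} clA clB i∈ adj = x∈p∪q⁺ ([ (λ i∈A → inj₁ (clA i∈A adj)) , (λ i∈B → inj₂ (clB i∈B adj)) ]′ (x∈p∪q⁻ A B i∈))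

  walk-closed : ∀ {A B X Y} → Closed G B → X ∈ B → Walk G A X Y → Y ∈ B
  walk-closed clB X∈B (here _)       = X∈B
  walk-closed clB X∈B (step _ adj w) = walk-closed clB (clB X∈B adj) w

  connected⇒⊆closed : ∀ {A B i} → Connected G A → Closed G B → i ∈ A → i ∈ B → A ⊆ B
  connected⇒⊆closed con clB i∈A i∈B j∈A = walk-closed clB i∈B (con _ _ i∈A j∈A)

  -- Adding to `A` an edge adjacent to one of its members keeps it connected, so maximality already
  -- puts that edge in `A`.
  maximal⇒closed : ∀ {A} → Connected G A → (∀ H → A ⊆ H → Connected G H → H ⊆ A) → Closed G A
  maximal⇒closed {A} con max {i} {j} i∈A adj = max H A⊆H conH j∈H
    where
    H = A ∪ ⁅ j ⁆

    A⊆H : A ⊆ H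
    A⊆H = p⊆p∪q ⁅ j ⁆

    j∈H : j ∈ H
    j∈H = q⊆p∪q A ⁅ j ⁆ (x∈⁅x⁆ j)

    conH : Connected G H
    conH X Y X∈H Y∈H with x∈p∪q⁻ A ⁅ j ⁆ X∈H | x∈p∪q⁻ A ⁅ j ⁆ Y∈H
    ... | inj₁ X∈A | inj₁ Y∈A = walk-mono A⊆H (con X Y X∈A Y∈A)
    ... | inj₁ X∈A | inj₂ Y∈j rewrite x∈⁅y⁆⇒x≡y j Y∈j = walk-snoc (walk-mono A⊆H (con X i X∈A i∈A)) adj j∈H
    ... | inj₂ X∈j | inj₁ Y∈A rewrite x∈⁅y⁆⇒x≡y j X∈j =
      step j∈H (subst (λ p → 2 ≤ ∣ p ∣) (∩-comm (G i) (G j)) adj) (walk-mono A⊆H (con i Y i∈A Y∈A))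
    ... | inj₂ X∈j | inj₂ Y∈j rewrite x∈⁅y⁆⇒x≡y j X∈j | x∈⁅y⁆⇒x≡y j Y∈j = here j∈H

-- Mergeability in a symmetric form: positive `i` and `j` with sum 3 are 1 and 2 in either order, so
-- both directions are handled at once.
Link : ∀ {n m} → ℕ → (Fin m → Subset n) → Subset m → Subset m → Set
Link r G A B = ∃[ x ] ∃[ y ] ∃[ i ] ∃[ j ]
  (x ≢ y × 1 ≤ i × 1 ≤ j × i + j ≡ 3 × InC r G A x y i × InC r G B x y j)

record Cluster {n m : ℕ} (G : Fin m → Subset n) (C : Subset m) : Set where
  field
    nonempty  : Nonempty C
    connected : Connected G C
    closed    : Closed G C

-- The merging history of a part. The numeric index counts the leaves, that is, the 1-clusters that
-- were merged.
data Tree {n m : ℕ} (r : ℕ) (G : Fin m → Subset n) : ℕ → Subset m → Set where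
  cluster : ∀ {C} → Cluster G C → Tree r G 1 C
  node    : ∀ {a b A B} → Tree r G a A → Tree r G b B → Disjoint A B → Link r G A B → Tree r G (a + b) (A ∪ B)

module _ {n m r : ℕ} {G : Fin m → Subset n} where

  link-sym : ∀ {A B} → Link r G A B → Link r G B A
  link-sym (x , y , i , j , x≢y , 1≤i , 1≤j , i+j≡3 , inA , inB) =
    x , y , j , i , x≢y , 1≤j , 1≤i , trans (+-comm j i) i+j≡3 , inB , inA

  link-monoˡ : ∀ {A A′ B} → A ⊆ A′ → Link r G A B → Link r G A′ B
  link-monoˡ A⊆A′ (x , y , i , j , x≢y , 1≤i , 1≤j , i+j≡3 , (D , D⊆A , rest) , inB) =
    x , y , i , j , x≢y , 1≤i , 1≤j , i+j≡3 , (D , A⊆A′ ∘ D⊆A , rest) , inB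

  mergeable⇒link : ∀ {A B} → Mergeable r G A B → Link r G A B
  mergeable⇒link (x , y , x≢y , inj₁ (inA , inB)) = x , y , 1 , 2 , x≢y , s≤s z≤n , s≤s z≤n , refl , inA , inB
  mergeable⇒link (x , y , x≢y , inj₂ (inA , inB)) = x , y , 2 , 1 , x≢y , s≤s z≤n , s≤s z≤n , refl , inA , inB

  tree-closed : ∀ {c T} → Tree r G c T → Closed G T
  tree-closed (cluster cl)      = Cluster.closed cl
  tree-closed (node tA tB _ _) = closed-∪ {G = G} (tree-closed tA) (tree-closed tB)

  tree-nonempty : ∀ {c T} → Tree r G c T → Nonempty T
  tree-nonempty (cluster cl)      = Cluster.nonempty cl
  tree-nonempty (node tA tB _ _) = let i , i∈ = tree-nonempty tA in i , p⊆p∪q _ i∈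

  -- Every cluster has an edge, which gives the weak bound. At a node, one side of the link has a
  -- two-edge witness, so the strict bound applies to that side and the weak one to the other.
  tree-clusters : ∀ {c T} → Tree r G c T → c ≤ ∣ T ∣ × (2 ≤ ∣ T ∣ → c + 1 ≤ ∣ T ∣)
  tree-clusters (cluster cl) = nonempty⇒∣p∣≥1 (Cluster.nonempty cl) , λ 2≤ → 2≤
  tree-clusters (node {a} {b} {A} {B} tA tB A∥B (_ , _ , i , j , _ , 1≤i , 1≤j , i+j≡3 , (D , D⊆A , ∣D∣≡i , _) , (E , E⊆B , ∣E∣≡j , _)))
    rewrite disjoint⇒∣p∪q∣≡∣p∣+∣q∣ {p = A} {B} A∥B =
    +-mono-≤ (proj₁ (tree-clusters tA)) (proj₁ (tree-clusters tB)) , λ _ → strict i j 1≤i 1≤j i+j≡3 i≤A j≤B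
    where
    i≤A : i ≤ ∣ A ∣
    i≤A = subst (_≤ ∣ A ∣) ∣D∣≡i (p⊆q⇒∣p∣≤∣q∣ D⊆A)

    j≤B : j ≤ ∣ B ∣
    j≤B = subst (_≤ ∣ B ∣) ∣E∣≡j (p⊆q⇒∣p∣≤∣q∣ E⊆B)

    strict : ∀ i j → 1 ≤ i → 1 ≤ j → i + j ≡ 3 → i ≤ ∣ A ∣ → j ≤ ∣ B ∣ → a + b + 1 ≤ ∣ A ∣ + ∣ B ∣
    strict 1 2 _ _ _ _ 2≤B = subst (_≤ ∣ A ∣ + ∣ B ∣) (sym (+-assoc a b 1))
      (+-mono-≤ (proj₁ (tree-clusters tA)) (proj₂ (tree-clusters tB) 2≤B))
    strict 2 1 _ _ _ 2≤A _ = subst (_≤ ∣ A ∣ + ∣ B ∣) (trans (+-assoc a 1 b) (trans (cong (a +_) (+-comm 1 b)) (sym (+-assoc a b 1))))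
      (+-mono-≤ (proj₂ (tree-clusters tA) 2≤A) (proj₁ (tree-clusters tB)))
    strict zero          _                   () _  _  _ _
    strict (suc _)       zero                _  () _  _ _
    strict 1             1                   _  _  () _ _
    strict 1             (suc (suc (suc _))) _  _  () _ _
    strict 2             (suc (suc _))       _  _  () _ _
    strict (suc (suc (suc _))) (suc j)       _  _  e _ _ with trans (sym (+-suc _ j)) (suc-injective (suc-injective (suc-injective e)))
    ... | ()

module Sparse {n m : ℕ} (r k : ℕ) (3≤r : 3 ≤ r) (3≤k : 3 ≤ k) (G : Fin m → Subset n)
  (uniform : ∀ i → ∣ G i ∣ ≡ r) (free : GkFree r k G) where

  d : ℕ
  d = r ∸ 2

  d+2≡r : d + 2 ≡ r
  d+2≡r = m∸n+n≡m (≤-trans (n≤1+n 2) 3≤r)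

  -- Good sets and the vertices of link witnesses.

  Good : Subset m → Set
  Good S = ∣ V G S ∣ ≤ d * ∣ S ∣ + 2

  good⇒∣S∣≢k : ∀ {S} → Good S → ∣ S ∣ ≢ k
  good⇒∣S∣≢k {S} good eq = free S (inj₁ (eq , subst (λ s → ∣ V G S ∣ ≤ d * s + 2) eq good))

  -- One edge has r = d + 2 vertices. Two edges on at most 2d + 1 vertices are forbidden by the case
  -- of size 2, which is below k since k ≥ 3.
  ∣V∣-lower : ∀ {S i} → 1 ≤ i → i ≤ 2 → ∣ S ∣ ≡ i → d * i + 2 ≤ ∣ V G S ∣
  ∣V∣-lower {S} {1} _ _ eq =
    let e , e∈S = ∣p∣≥1⇒nonempty S (≤-reflexive (sym eq)) in
    ≤-trans (≤-reflexive (trans (cong (_+ 2) (*-identityʳ d)) (trans d+2≡r (sym (uniform e)))))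
            (p⊆q⇒∣p∣≤∣q∣ (G⊆V {G = G} e∈S))
  ∣V∣-lower {S} {2} _ _ eq with d * 2 + 2 ≤? ∣ V G S ∣
  ... | yes le = le
  ... | no  ≰  = ⊥-elim (free S (inj₂ (≤-reflexive (sym eq) , ≤-trans (≤-reflexive (cong (_+ 1) eq)) 3≤k ,
    m<1+n⇒m≤n (subst (∣ V G S ∣ <_) (trans (cong (λ s → d * s + 2) (sym eq)) (+-suc _ 1)) (≰⇒> ≰)))))
  ∣V∣-lower {S} {suc (suc (suc _))} _ (s≤s (s≤s ())) _

  -- The upper bound in the definition of `InC` meets the lower bound `∣V∣-lower`, so adding x and y
  -- creates no new vertex.
  linked-pair⊆V : ∀ {D x y i} → 1 ≤ i → i ≤ 2 → ∣ D ∣ ≡ i →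
    ∣ (⁅ x ⁆ ∪ ⁅ y ⁆) ∪ V G D ∣ ≤ d * i + 2 → ⁅ x ⁆ ∪ ⁅ y ⁆ ⊆ V G D
  linked-pair⊆V 1≤i i≤2 eq le = ∣q∪p∣≤∣p∣⇒q⊆p (≤-trans le (∣V∣-lower 1≤i i≤2 eq))

  -- Two edges have 2r = 2d + 4 vertices with multiplicity, but the witness spans at most 2d + 2, so
  -- they overlap in two. The argument also covers `e` equal to `f`.
  witness-adjacent : ∀ {D x y i e f} → i ≤ 2 → ∣ (⁅ x ⁆ ∪ ⁅ y ⁆) ∪ V G D ∣ ≤ d * i + 2 →
    e ∈ D → f ∈ D → 2 ≤ ∣ G e ∩ G f ∣
  witness-adjacent {D} {x} {y} {i} {e} {f} i≤2 le e∈D f∈D = +-cancelˡ-≤ (d * 2 + 2) _ _ (begin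
    d * 2 + 2 + 2                      ≡⟨ solve 1 (λ d → d :* con 2 :+ con 2 :+ con 2 := (d :+ con 2) :+ (d :+ con 2)) refl d ⟩
    (d + 2) + (d + 2)                  ≡⟨ cong₂ _+_ d+2≡r d+2≡r ⟩
    r + r                              ≡⟨ cong₂ _+_ (uniform e) (uniform f) ⟨
    ∣ G e ∣ + ∣ G f ∣                  ≡⟨ ∣p∪q∣+∣p∩q∣≡∣p∣+∣q∣ (G e) (G f) ⟨
    ∣ G e ∪ G f ∣ + ∣ G e ∩ G f ∣      ≤⟨ +-monoˡ-≤ _ (p⊆q⇒∣p∣≤∣q∣ Ge∪Gf⊆) ⟩
    ∣ (⁅ x ⁆ ∪ ⁅ y ⁆) ∪ V G D ∣ + ∣ G e ∩ G f ∣   ≤⟨ +-monoˡ-≤ _ le ⟩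
    d * i + 2 + ∣ G e ∩ G f ∣          ≤⟨ +-monoˡ-≤ _ (+-monoˡ-≤ 2 (*-monoʳ-≤ d i≤2)) ⟩
    d * 2 + 2 + ∣ G e ∩ G f ∣          ∎)
    where
    open ≤-Reasoning
    open +-*-Solver
    Ge∪Gf⊆ : G e ∪ G f ⊆ (⁅ x ⁆ ∪ ⁅ y ⁆) ∪ V G D
    Ge∪Gf⊆ z∈ = q⊆p∪q _ _ (∪-lub (G⊆V {G = G} e∈D) (G⊆V {G = G} f∈D) z∈)

  -- Growing good sets.

  GrowsBy : ℕ → Subset m → Subset m → Set
  GrowsBy i S T = ∃[ S′ ] (S ⊆ S′ × S′ ⊆ S ∪ T × Good S′ × ∣ S′ ∣ ≡ ∣ S ∣ + i)

  growsBy-mono : ∀ {i S T T′} → T ⊆ T′ → GrowsBy i S T → GrowsBy i S T′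
  growsBy-mono {S = S} T⊆T′ (S′ , S⊆S′ , S′⊆ , rest) =
    S′ , S⊆S′ , (λ x∈ → ∪-lub (p⊆p∪q _) (λ x∈T → q⊆p∪q S _ (T⊆T′ x∈T)) (S′⊆ x∈)) , rest

  -- Inclusion-exclusion for `V G S` and `W`: an overlap of two vertices pays for the second
  -- constant 2. `W` may exceed `V G D` so that a linking pair can be put into it.
  extend : ∀ {S D T W i} → Good S → Disjoint S D → D ⊆ T → ∣ D ∣ ≡ i →
    V G D ⊆ W → ∣ W ∣ ≤ d * i + 2 → 2 ≤ ∣ V G S ∩ W ∣ → GrowsBy i S T
  extend {S} {D} {T} {W} {i} good S∥D D⊆T ∣D∣≡i VD⊆W ∣W∣≤ 2≤ =
    S ∪ D , p⊆p∪q D , ∪-lub (p⊆p∪q T) (λ x∈ → q⊆p∪q S T (D⊆T x∈)) , good′ , size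
    where
    size : ∣ S ∪ D ∣ ≡ ∣ S ∣ + i
    size = trans (disjoint⇒∣p∪q∣≡∣p∣+∣q∣ {p = S} {D} S∥D) (cong (∣ S ∣ +_) ∣D∣≡i)

    VSD⊆ : V G (S ∪ D) ⊆ V G S ∪ W
    VSD⊆ x∈ = ∪-lub (p⊆p∪q W) (λ x∈D → q⊆p∪q (V G S) W (VD⊆W x∈D)) (V-∪ {G = G} S D x∈)

    open ≤-Reasoning
    open +-*-Solver
    good′ : Good (S ∪ D)
    good′ = +-cancelʳ-≤ 2 _ _ (begin
      ∣ V G (S ∪ D) ∣ + 2                  ≤⟨ +-mono-≤ (p⊆q⇒∣p∣≤∣q∣ VSD⊆) 2≤ ⟩
      ∣ V G S ∪ W ∣ + ∣ V G S ∩ W ∣        ≡⟨ ∣p∪q∣+∣p∩q∣≡∣p∣+∣q∣ (V G S) W ⟩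
      ∣ V G S ∣ + ∣ W ∣                    ≤⟨ +-mono-≤ good ∣W∣≤ ⟩
      d * ∣ S ∣ + 2 + (d * i + 2)          ≡⟨ solve 3 (λ d s i → d :* s :+ con 2 :+ (d :* i :+ con 2) := d :* (s :+ i) :+ con 2 :+ con 2) refl d ∣ S ∣ i ⟩
      d * (∣ S ∣ + i) + 2 + 2              ≡⟨ cong (λ s → d * s + 2 + 2) size ⟨
      d * ∣ S ∪ D ∣ + 2 + 2                ∎)

  -- An edge sharing two vertices with an edge of `S` brings at most r - 2 = d new vertices.
  extend-adjacent : ∀ {S T e f} → Good S → e ∈ S → f ∉ S → f ∈ T → 2 ≤ ∣ G e ∩ G f ∣ → GrowsBy 1 S T
  extend-adjacent {S} {T} {e} {f} good e∈S f∉S f∈T adj = extend {W = G f} good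
    (λ x∈S x∈f → f∉S (subst (_∈ S) (x∈⁅y⁆⇒x≡y f x∈f) x∈S))
    (λ x∈f → subst (_∈ T) (sym (x∈⁅y⁆⇒x≡y f x∈f)) f∈T)
    (∣⁅x⁆∣≡1 f)
    (V⊆ ⁅ f ⁆ λ i∈f → subst (λ i → G i ⊆ G f) (sym (x∈⁅y⁆⇒x≡y f i∈f)) ⊆-refl)
    (≤-reflexive (trans (uniform f) (trans (sym d+2≡r) (cong (_+ 2) (sym (*-identityʳ d))))))
    (≤-trans adj (p⊆q⇒∣p∣≤∣q∣ λ x∈ →
      let x∈e , x∈f = x∈p∩q⁻ (G e) (G f) x∈ in x∈p∩q⁺ (G⊆V {G = G} e∈S x∈e , x∈f)))

  extend-linked : ∀ {S D T x y i} → x ≢ y → Good S → Disjoint S D → D ⊆ T → ∣ D ∣ ≡ i →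
    ∣ (⁅ x ⁆ ∪ ⁅ y ⁆) ∪ V G D ∣ ≤ d * i + 2 → ⁅ x ⁆ ∪ ⁅ y ⁆ ⊆ V G S → GrowsBy i S T
  extend-linked {S} {D} {T} {x} {y} x≢y good S∥D D⊆T ∣D∣≡i le xy⊆ =
    extend {W = (⁅ x ⁆ ∪ ⁅ y ⁆) ∪ V G D} good S∥D D⊆T ∣D∣≡i (q⊆p∪q (⁅ x ⁆ ∪ ⁅ y ⁆) (V G D)) le
    (≤-trans (≤-reflexive (sym (x≢y⇒∣⁅x⁆∪⁅y⁆∣≡2 x≢y))) (p⊆q⇒∣p∣≤∣q∣ λ z∈ → x∈p∩q⁺ (xy⊆ z∈ , p⊆p∪q _ z∈)))

  i+j≡3⇒i≤2 : ∀ {i j} → 1 ≤ j → i + j ≡ 3 → i ≤ 2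
  i+j≡3⇒i≤2 {i} {suc j} _ eq = ≤-trans (m≤m+n i j) (≤-reflexive (suc-injective (trans (sym (+-suc i j)) eq)))

  -- `S` contains the witness `D` in `A`, hence `V G S` contains the pair, and the whole witness `E`
  -- on the other side can be added.
  cross : ∀ {S A B} → Good S → A ⊆ S → Disjoint S B → Link r G A B → ∃[ i ] (1 ≤ i × i ≤ 2 × GrowsBy i S B)
  cross {S} good A⊆S S∥B (x , y , i , j , x≢y , 1≤i , 1≤j , i+j≡3 , (D , D⊆A , ∣D∣≡i , leD) , (E , E⊆B , ∣E∣≡j , leE)) =
    j , 1≤j , i+j≡3⇒i≤2 1≤i (trans (+-comm j i) i+j≡3) ,
    extend-linked x≢y good (λ z∈S z∈E → S∥B z∈S (E⊆B z∈E)) E⊆B ∣E∣≡j leE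
      (⊆-trans (linked-pair⊆V 1≤i (i+j≡3⇒i≤2 1≤j i+j≡3) ∣D∣≡i leD)
        (V⊆ D λ i∈D → G⊆V {G = G} {S = S} (A⊆S (D⊆A i∈D))))

  -- Follow a walk from inside `S` to outside; the first edge that leaves `S` is adjacent to its
  -- predecessor in `S` and can be added.
  grow-cluster : ∀ {S C a b} → Connected G C → Good S → a ∈ C → a ∈ S → b ∈ C → b ∉ S → GrowsBy 1 S C
  grow-cluster {S} {C} con good a∈C a∈S b∈C b∉S = along (con _ _ a∈C b∈C) a∈S b∉S
    where
    along : ∀ {a b} → Walk G C a b → a ∈ S → b ∉ S → GrowsBy 1 S C
    along (here _) a∈S b∉S = ⊥-elim (b∉S a∈S)
    along (step {Z = z} _ adj w) a∈S b∉S with z ∈? S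
    ... | yes z∈S = along w z∈S b∉S
    ... | no  z∉S = extend-adjacent good a∈S z∉S (walk-start w) adj

  data Status (S A : Subset m) : Set where
    full    : A ⊆ S → Status S A
    untouch : Disjoint S A → Status S A
    partial : ∀ {a b} → a ∈ A → a ∈ S → b ∈ A → b ∉ S → Status S A

  status : ∀ S A → Status S A
  status S A with A ⊆? S | nonempty? (S ∩ A)
  ... | yes A⊆S | _ = full A⊆S
  ... | no _    | no em = untouch λ x∈S x∈A → em (_ , x∈p∩q⁺ (x∈S , x∈A))
  ... | no A⊈S  | yes (a , a∈) =
    let a∈S , a∈A = x∈p∩q⁻ S A a∈ ; b , b∈A , b∉S = ⊈⇒∃∉ A⊈S in partial a∈A a∈S b∈A b∉S

  Grows : Subset m → Subset m → Set
  Grows S T = ∃[ i ] (1 ≤ i × i ≤ 2 × GrowsBy i S T)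

  grows-mono : ∀ {S T T′} → T ⊆ T′ → Grows S T → Grows S T′
  grows-mono T⊆T′ (i , 1≤i , i≤2 , g) = i , 1≤i , i≤2 , growsBy-mono T⊆T′ g

  -- Descend into a half that `S` meets without containing it. If there is none, `S` contains one
  -- half and misses the other, and the link leads across.
  grow-tree : ∀ {c S T a b} → Tree r G c T → Good S → a ∈ T → a ∈ S → b ∈ T → b ∉ S → Grows S T
  grow-tree (cluster cl) good a∈T a∈S b∈T b∉S =
    1 , ≤-refl , n≤1+n 1 , grow-cluster (Cluster.connected cl) good a∈T a∈S b∈T b∉S
  grow-tree {S = S} (node {A = A} {B} tA tB _ link) good a∈T a∈S b∈T b∉S with status S A | status S B
  ... | partial p q u v | _ = grows-mono (p⊆p∪q B) (grow-tree tA good p q u v)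
  ... | full _    | partial p q u v = grows-mono (q⊆p∪q A B) (grow-tree tB good p q u v)
  ... | untouch _ | partial p q u v = grows-mono (q⊆p∪q A B) (grow-tree tB good p q u v)
  ... | full A⊆S    | untouch S∥B = grows-mono (q⊆p∪q A B) (cross good A⊆S S∥B link)
  ... | untouch S∥A | full B⊆S    = grows-mono (p⊆p∪q B) (cross good B⊆S S∥A (link-sym {r = r} {G = G} link))
  ... | full A⊆S    | full B⊆S    = ⊥-elim (b∉S (∪-lub A⊆S B⊆S b∈T))
  ... | untouch S∥A | untouch S∥B = ⊥-elim ([ S∥A a∈S , S∥B a∈S ]′ (x∈p∪q⁻ A B a∈T))

  -- Growth by one or two edges cannot jump past k - 1: from at most k - 2 it reaches at most k, and
  -- no good set has size k.
  reach : ∀ {c S T} → Tree r G c T → Good S → Nonempty S → S ⊆ T → ∣ S ∣ < k → k ≤ ∣ T ∣ →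
    ∃[ S′ ] (S ⊆ S′ × S′ ⊆ T × Good S′ × suc ∣ S′ ∣ ≡ k)
  reach {S = S₀} {T} t good₀ (a , a∈S₀) S₀⊆T S₀<k k≤T = go k S₀ good₀ ⊆-refl S₀⊆T S₀<k (m≤n+m k (suc ∣ S₀ ∣))
    where
    go : ∀ fuel S → Good S → S₀ ⊆ S → S ⊆ T → ∣ S ∣ < k → k ≤ suc ∣ S ∣ + fuel →
      ∃[ S′ ] (S₀ ⊆ S′ × S′ ⊆ T × Good S′ × suc ∣ S′ ∣ ≡ k)
    -- Without fuel the invariant gives k ≤ |S| + 1, and |S| < k makes this an equality.
    go zero S good S₀⊆S S⊆T S<k k≤ =
      S , S₀⊆S , S⊆T , good , ≤-antisym S<k (subst (k ≤_) (+-identityʳ _) k≤)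
    go (suc fuel) S good S₀⊆S S⊆T S<k k≤ with suc ∣ S ∣ ≟ k
    ... | yes eq = S , S₀⊆S , S⊆T , good , eq
    ... | no  ≢k with ∣q∣<∣p∣⇒∃∉ (<-≤-trans S<k k≤T)
    ... | b , b∈T , b∉S with grow-tree t good (S₀⊆T a∈S₀) (S₀⊆S a∈S₀) b∈T b∉S
    ... | i , 1≤i , i≤2 , S′ , S⊆S′ , S′⊆ , good′ , size =
      go fuel S′ good′ (⊆-trans S₀⊆S S⊆S′) (⊆-trans S′⊆ (∪-lub S⊆T ⊆-refl))
        (≤∧≢⇒< S′≤k (good⇒∣S∣≢k good′))
        (≤-trans k≤ (subst (suc ∣ S ∣ + suc fuel ≤_) (cong (λ s → suc s + fuel) (sym size))
          (s≤s (≤-trans (≤-reflexive (trans (+-suc _ fuel) (cong (_+ fuel) (+-comm 1 _)))) (+-monoˡ-≤ fuel (+-monoʳ-≤ ∣ S ∣ 1≤i))))))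
      where
      S′≤k : ∣ S′ ∣ ≤ k
      S′≤k = subst (_≤ k) (sym size) (≤-trans (+-monoʳ-≤ ∣ S ∣ i≤2)
        (subst (_≤ k) (+-comm 2 ∣ S ∣) (≤∧≢⇒< S<k ≢k)))

  seed-good : ∀ e → Good ⁅ e ⁆
  seed-good e = ≤-trans (p⊆q⇒∣p∣≤∣q∣ V⊆Ge) (≤-reflexive
    (trans (uniform e) (trans (sym d+2≡r) (cong (_+ 2) (trans (sym (*-identityʳ d)) (cong (d *_) (sym (∣⁅x⁆∣≡1 e))))))))
    where
    V⊆Ge : V G ⁅ e ⁆ ⊆ G e
    V⊆Ge = V⊆ ⁅ e ⁆ λ i∈ → subst (λ i → G i ⊆ G e) (sym (x∈⁅y⁆⇒x≡y e i∈)) ⊆-refl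

  almost-k : ∀ {c T} → Tree r G c T → k ≤ ∣ T ∣ →
    ∃[ S ] (Nonempty S × S ⊆ T × Good S × suc ∣ S ∣ ≡ k)
  almost-k {T = T} t k≤T =
    let e , e∈T = tree-nonempty t
        S , e⊆S , S⊆T , good , eq = reach t (seed-good e) (e , x∈⁅x⁆ e)
          (λ x∈ → subst (_∈ T) (sym (x∈⁅y⁆⇒x≡y e x∈)) e∈T)
          (subst (_< k) (sym (∣⁅x⁆∣≡1 e)) (≤-trans (n≤1+n 2) 3≤k)) k≤T
    in S , (e , e⊆S (x∈⁅x⁆ e)) , S⊆T , good , eq

  -- Inside a cluster growth is by exactly one edge, so a good set of size k - 1 would grow to one
  -- of size k.
  cluster-<k : ∀ {C} → Cluster G C → ∣ C ∣ < k
  cluster-<k {C} cl with k ≤? ∣ C ∣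
  ... | no  k≰C = ≰⇒> k≰C
  ... | yes k≤C =
    let S , (a , a∈S) , S⊆C , good , eq = almost-k (cluster cl) k≤C
        b , b∈C , b∉S = ∣q∣<∣p∣⇒∃∉ {p = C} (subst (_≤ ∣ C ∣) (sym eq) k≤C)
        S′ , _ , _ , good′ , size = grow-cluster (Cluster.connected cl) good (S⊆C a∈S) a∈S b∈C b∉S
    in ⊥-elim (good⇒∣S∣≢k good′ (trans size (trans (+-comm _ 1) eq)))

  -- If `T` had k edges, growing a good set of size k - 1 inside it could add only one edge, giving
  -- a good set of size k.
  tree-≢k : ∀ {c T} → Tree r G c T → ∣ T ∣ ≢ k
  tree-≢k {T = T} t ∣T∣≡k with almost-k t (≤-reflexive (sym ∣T∣≡k))
  ... | S , (a , a∈S) , S⊆T , good , eq with ∣q∣<∣p∣⇒∃∉ {p = T} (≤-reflexive (trans eq (sym ∣T∣≡k)))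
  ... | b , b∈T , b∉S with grow-tree t good (S⊆T a∈S) a∈S b∈T b∉S
  ... | i , 1≤i , _ , S′ , _ , S′⊆ , good′ , size = good⇒∣S∣≢k good′ (≤-antisym
    (subst (∣ S′ ∣ ≤_) ∣T∣≡k (p⊆q⇒∣p∣≤∣q∣ (⊆-trans S′⊆ (∪-lub S⊆T ⊆-refl))))
    (subst₂ _≤_ (trans (+-comm _ 1) eq) (sym size) (+-monoʳ-≤ ∣ S ∣ 1≤i)))

  -- Splitting off a leaf.

  record LeafSplit (e : Fin m) (c : ℕ) (T : Subset m) : Set where
    field
      {rest leaf} : Subset m
      {c′}        : ℕ
      union       : T ≡ rest ∪ leaf
      count       : c ≡ suc c′
      rest-tree   : Tree r G c′ rest
      isCluster   : Cluster G leaf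
      disjoint    : Disjoint rest leaf
      link        : Link r G rest leaf
      protected   : e ∈ rest

  -- The quantifier over `e` is what makes the induction work: the caller chooses an edge that must
  -- survive the removal of the leaf.
  Splits : ℕ → Subset m → Set
  Splits c T = ∀ {e} → e ∈ T → (Cluster G T × c ≡ 1) ⊎ LeafSplit e c T

  -- The leaf is split off from B while protecting one edge of the link's witness in B;
  -- by closedness a second witness edge is then kept as well.
  split-node : ∀ {a b A B e} → Tree r G a A → Disjoint A B → Link r G A B → Splits b B → e ∈ A →
    LeafSplit e (a + b) (A ∪ B)
  split-node {a} {A = A} {B} tA A∥B link@(x , y , i , j , x≢y , 1≤i , 1≤j , i+j≡3 , inA , (E , E⊆B , ∣E∣≡j , leE)) splitB e∈A
    with ∣p∣≥1⇒nonempty E (subst (1 ≤_) (sym ∣E∣≡j) 1≤j)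
  ... | g , g∈E with splitB (E⊆B g∈E)
  ... | inj₁ (cl , refl) = record
    { union = refl ; count = +-comm a 1 ; rest-tree = tA ; isCluster = cl
    ; disjoint = A∥B ; link = link ; protected = e∈A }
  ... | inj₂ record { rest = S ; leaf = L ; c′ = c′ ; union = refl ; count = refl ; rest-tree = tS
                    ; isCluster = cl ; disjoint = S∥L ; link = linkSL ; protected = g∈S } = record
    { union = sym (∪-assoc A S L)
    ; count = +-suc a c′
    ; rest-tree = node tA tS (λ z∈A z∈S → A∥B z∈A (p⊆p∪q L z∈S))
        (x , y , i , j , x≢y , 1≤i , 1≤j , i+j≡3 , inA ,
          (E , (λ h∈E → tree-closed tS g∈S (witness-adjacent {x = x} {y} j≤2 leE g∈E h∈E)) , ∣E∣≡j , leE))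
    ; isCluster = cl
    ; disjoint = λ z∈ z∈L → [ (λ z∈A → A∥B z∈A (q⊆p∪q S L z∈L)) , (λ z∈S → S∥L z∈S z∈L) ]′ (x∈p∪q⁻ A S z∈)
    ; link = link-monoˡ {r = r} {G = G} (q⊆p∪q A S) linkSL
    ; protected = p⊆p∪q S e∈A }
    where
    j≤2 : j ≤ 2
    j≤2 = i+j≡3⇒i≤2 1≤i (trans (+-comm j i) i+j≡3)

  -- The leaf is taken from the half that does not contain `e`.
  split : ∀ {c T} → Tree r G c T → Splits c T
  split (cluster cl) _ = inj₁ (cl , refl)
  split (node {a} {b} {A} {B} tA tB A∥B link) e∈ with x∈p∪q⁻ A B e∈
  ... | inj₁ e∈A = inj₂ (split-node tA A∥B link (split tB) e∈A)
  ... | inj₂ e∈B = inj₂ (subst₂ (LeafSplit _) (+-comm b a) (∪-comm B A)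
    (split-node tB (disjoint-sym {p = A} {B} A∥B) (link-sym {r = r} {G = G} link) (split tA) e∈B))

  -- Growth starts from the witness `D` itself, so the pair stays covered when size k - 1 is
  -- reached. The witness in `L` is a single edge, and adding it gives exactly k.
  no-singleton-leaf : ∀ {c S L} → Tree r G c S → Disjoint S L → Link r G S L → ∣ L ∣ ≡ 1 → ¬ k ≤ ∣ S ∣
  no-singleton-leaf {S = S} {L} tS S∥L (x , y , i , j , x≢y , 1≤i , 1≤j , i+j≡3 , (D , D⊆S , ∣D∣≡i , leD) , (E , E⊆L , ∣E∣≡j , leE)) ∣L∣≡1 k≤S =
    let S′ , D⊆S′ , S′⊆S , good , eq = reach tS goodD (∣p∣≥1⇒nonempty D (subst (1 ≤_) (sym ∣D∣≡i) 1≤i)) D⊆S D<k k≤S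
        _ , _ , _ , good′ , size = extend-linked x≢y good (λ z∈S′ z∈E → S∥L (S′⊆S z∈S′) (E⊆L z∈E)) (⊆-refl {x = E}) ∣E∣≡j leE
          (⊆-trans (linked-pair⊆V 1≤i i≤2 ∣D∣≡i leD) (V⊆ D λ i∈D → G⊆V {G = G} {S = S′} (D⊆S′ i∈D)))
    in good⇒∣S∣≢k good′ (trans size (trans (cong (∣ S′ ∣ +_) j≡1) (trans (+-comm _ 1) eq)))
    where
    i≤2 : i ≤ 2
    i≤2 = i+j≡3⇒i≤2 1≤j i+j≡3

    j≡1 : j ≡ 1
    j≡1 = ≤-antisym (subst₂ _≤_ ∣E∣≡j ∣L∣≡1 (p⊆q⇒∣p∣≤∣q∣ E⊆L)) 1≤j

    D<k : ∣ D ∣ < k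
    D<k = ≤-trans (s≤s (subst (_≤ 2) (sym ∣D∣≡i) i≤2)) 3≤k

    goodD : Good D
    goodD = ≤-trans (p⊆q⇒∣p∣≤∣q∣ (q⊆p∪q (⁅ x ⁆ ∪ ⁅ y ⁆) (V G D))) (subst (λ s → ∣ (⁅ x ⁆ ∪ ⁅ y ⁆) ∪ V G D ∣ ≤ d * s + 2) (sym ∣D∣≡i) leD)

  -- The bound for trees.

  tree-bound : ∀ c {T} → Tree r G c T → k < ∣ T ∣ → 2 * c + 3 ≤ ∣ T ∣ + k
  -- Any edge may be protected here; protection serves the recursion inside `split`.
  tree-bound c t k<T with split t (proj₂ (tree-nonempty t))
  ... | inj₁ (cl , _) = ⊥-elim (<-asym k<T (cluster-<k cl))
  -- The recursion is on the number of clusters, since the rest is not a syntactic subtree of `t`.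
  tree-bound (suc c) t k<T | inj₂ record { rest = S ; leaf = L ; union = refl ; count = refl ; rest-tree = tS
                    ; isCluster = cl ; disjoint = S∥L ; link = link }
    rewrite disjoint⇒∣p∪q∣≡∣p∣+∣q∣ {p = S} {L} S∥L with ∣ L ∣ ≟ 1
  ... | yes L≡1 = ⊥-elim (no-singleton-leaf tS S∥L link L≡1
    (m<1+n⇒m≤n (subst (k <_) (trans (cong (∣ S ∣ +_) L≡1) (+-comm _ 1)) k<T)))
  ... | no  L≢1 = bound (<-cmp ∣ S ∣ k)
    where
    open ≤-Reasoning
    open +-*-Solver
    2≤L : 2 ≤ ∣ L ∣
    2≤L = ≤∧≢⇒< (nonempty⇒∣p∣≥1 (Cluster.nonempty cl)) (L≢1 ∘ sym)

    -- With at least two edges, c + 1 ≤ |S| ≤ k - 1; otherwise c ≤ 1 and k ≥ 3 suffices.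
    c+2≤k : ∣ S ∣ < k → c + 2 ≤ k
    c+2≤k S<k with 2 ≤? ∣ S ∣
    ... | yes 2≤S = ≤-trans (≤-reflexive (+-suc c 1)) (≤-trans (s≤s (proj₂ (tree-clusters tS) 2≤S)) S<k)
    ... | no  2≰S = ≤-trans (+-monoˡ-≤ 2 (≤-trans (proj₁ (tree-clusters tS)) (m<1+n⇒m≤n (≰⇒> 2≰S)))) 3≤k

    bound : Tri (∣ S ∣ < k) (∣ S ∣ ≡ k) (k < ∣ S ∣) → 2 * suc c + 3 ≤ ∣ S ∣ + ∣ L ∣ + k
    bound (tri< S<k _ _) = begin
      2 * suc c + 3            ≡⟨ solve 1 (λ c → con 2 :* (con 1 :+ c) :+ con 3 := con 1 :+ (c :+ con 2) :+ (c :+ con 2)) refl c ⟩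
      1 + (c + 2) + (c + 2)    ≤⟨ +-mono-≤ (s≤s (c+2≤k S<k)) (c+2≤k S<k) ⟩
      suc k + k                ≤⟨ +-monoˡ-≤ k k<T ⟩
      ∣ S ∣ + ∣ L ∣ + k        ∎
    bound (tri≈ _ S≡k _) = ⊥-elim (tree-≢k tS S≡k)
    -- The one cluster `L` raises the left side by 2, which its two or more edges pay for.
    bound (tri> _ _ k<S) = begin
      2 * suc c + 3            ≡⟨ solve 1 (λ c → con 2 :* (con 1 :+ c) :+ con 3 := con 2 :* c :+ con 3 :+ con 2) refl c ⟩
      2 * c + 3 + 2            ≤⟨ +-mono-≤ (tree-bound c tS k<S) 2≤L ⟩
      ∣ S ∣ + k + ∣ L ∣        ≡⟨ solve 3 (λ s k l → s :+ k :+ l := s :+ l :+ k) refl (∣ S ∣) k (∣ L ∣) ⟩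
      ∣ S ∣ + ∣ L ∣ + k        ∎

-- Counting 1-clusters along the merges.

mnum-∪ : ∀ {n m} {G : Fin m → Subset n} {A B} → Closed G A → Closed G B →
  ∀ {Cs} → All (Cluster G) Cs → mnum Cs (A ∪ B) ≤ mnum Cs A + mnum Cs B
mnum-∪ clA clB [] = z≤n
mnum-∪ {A = A} {B} clA clB {C ∷ Cs} (cl ∷ cls) with C ⊆? A ∪ B | C ⊆? A | C ⊆? B | mnum-∪ clA clB cls
... | no  _ | yes _ | yes _ | ih = m≤n⇒m≤1+n (≤-trans ih (+-monoʳ-≤ _ (n≤1+n _)))
... | no  _ | yes _ | no _  | ih = m≤n⇒m≤1+n ih
... | no  _ | no _  | yes _ | ih = ≤-trans ih (+-monoʳ-≤ _ (n≤1+n _))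
... | no  _ | no _  | no _  | ih = ih
... | yes _ | yes _ | yes _ | ih = s≤s (≤-trans ih (+-monoʳ-≤ _ (n≤1+n _)))
... | yes _ | yes _ | no _  | ih = s≤s ih
... | yes _ | no _  | yes _ | ih = ≤-trans (s≤s ih) (≤-reflexive (sym (+-suc _ _)))
-- A connected `C` cannot straddle two closed sets: the one holding some edge of `C` holds all of
-- it.
... | yes C⊆A∪B | no C⊈A | no C⊈B | _ =
  let i , i∈C = Cluster.nonempty cl
      con     = Cluster.connected cl
  in ⊥-elim ([ (λ i∈A → C⊈A (connected⇒⊆closed con clA i∈C i∈A)) , (λ i∈B → C⊈B (connected⇒⊆closed con clB i∈C i∈B)) ]′
       (x∈p∪q⁻ A B (C⊆A∪B i∈C)))

-- A listed cluster inside `A` is closed and meets the connected `A`, so it contains `A`; two such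
-- clusters would not be disjoint.
mnum-cluster : ∀ {n m} {G : Fin m → Subset n} {A Cs} → Cluster G A → All (Cluster G) Cs →
  AllPairs (λ C D → C ∩ D ≡ ⊥) Cs → mnum Cs A ≤ 1
mnum-cluster {G = G} {A} {Cs} clA cls disj = go (AllPairs.filter⁺ (_⊆? A) disj) (λ D∈ →
    let D∈Cs , D⊆A = ∈-filter⁻ (_⊆? A) {xs = Cs} D∈
        clD = All.lookup cls D∈Cs
        i , i∈D = Cluster.nonempty clD
    in connected⇒⊆closed (Cluster.connected clA) (Cluster.closed clD) (D⊆A i∈D) i∈D)
  where
  go : ∀ {Ds} → AllPairs (λ C D → C ∩ D ≡ ⊥) Ds → (∀ {D} → D ∈L Ds → A ⊆ D) → length Ds ≤ 1
  go []       _  = z≤n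
  go (_ ∷ []) _  = ≤-refl
  go ((C∩D≡⊥ ∷ _) ∷ _ ∷ _) A⊆ =
    let i , i∈A = Cluster.nonempty clA
    in ⊥-elim (∩≡⊥⇒disjoint C∩D≡⊥ (A⊆ (here refl) i∈A) (A⊆ (there (here refl)) i∈A))

-- An upper bound on the merging number is enough, because the final inequality is monotone in it.
CountedTree : ∀ {n m} → ℕ → (Fin m → Subset n) → List (Subset m) → Subset m → Set
CountedTree r G Cs A = ∃[ c ] (Tree r G c A × mnum Cs A ≤ c)

Forest : ∀ {n m} → ℕ → (Fin m → Subset n) → List (Subset m) → List (Subset m) → Set
Forest r G Cs P = All (CountedTree r G Cs) P × AllPairs (λ A B → A ∩ B ≡ ⊥) P

mergeStep-forest : ∀ {n m r} {G : Fin m → Subset n} {Cs P Q} → All (Cluster G) Cs →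
  MergeStep r G P Q → Forest r G Cs P → Forest r G Cs Q
mergeStep-forest {m = m} {r} {G} cls (merge A B Q perm mergeable) (trees , disj)
  with All-resp-↭ perm trees
     -- Pairwise disjointness can be carried along a permutation because it is symmetric.
     | AllPairs-resp-↭ (≡.setoid (Subset m)) (λ {p} {q} → trans (∩-comm q p)) (≡.resp₂ _) (↭⇒↭ₛ perm) disj
... | (a , tA , mA) ∷ (b , tB , mB) ∷ tQ | (A∩B≡⊥ ∷ A∩Q≡⊥) ∷ B∩Q≡⊥ ∷ disjQ =
  (a + b , node tA tB (∩≡⊥⇒disjoint A∩B≡⊥) (mergeable⇒link {r = r} {G = G} mergeable) ,
    ≤-trans (mnum-∪ (tree-closed tA) (tree-closed tB) cls) (+-mono-≤ mA mB)) ∷ tQ ,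
  All.zipWith (λ (A∩C≡⊥ , B∩C≡⊥) → disjoint⇒∩≡⊥ λ x∈ →
    [ ∩≡⊥⇒disjoint A∩C≡⊥ , ∩≡⊥⇒disjoint B∩C≡⊥ ]′ (x∈p∪q⁻ A B x∈)) (A∩Q≡⊥ , B∩Q≡⊥) ∷ disjQ

merges-forest : ∀ {n m r} {G : Fin m → Subset n} {Cs P Q} → All (Cluster G) Cs →
  Star (MergeStep r G) P Q → Forest r G Cs P → Forest r G Cs Q
merges-forest cls ε        forest = forest
merges-forest cls (s ◅ ss) forest = merges-forest cls ss (mergeStep-forest cls s forest)

theorem3p7 : (r k n m : ℕ) → 3 ≤ r → 3 ≤ k
    → (G : Fin m → Subset n) → IsRGraph r G → GkFree r k G
    → (P1 : List (Subset m)) → IsM1 G P1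
    → (P : List (Subset m)) → IsM2 r G P1 P
    → (F : Subset m) → F ∈L P → k + 1 ≤ ∣ F ∣
    → 2 * mnum P1 F + 3 ≤ ∣ F ∣ + k
theorem3p7 r k n m 3≤r 3≤k G (_ , uniform) free P1 ((nonempty , disjoint , _) , maximal) P (merges , _) F F∈P k<F =
  let c , t , mnum≤c = All.lookup (proj₁ (merges-forest clusters merges forest)) F∈P
  in ≤-trans (+-monoˡ-≤ 3 (*-monoʳ-≤ 2 mnum≤c))
       (Sparse.tree-bound r k 3≤r 3≤k G uniform free c t (subst (_≤ ∣ F ∣) (+-comm k 1) k<F))
  where
  clusters : All (Cluster G) P1
  clusters = All.tabulate λ {A} A∈ → let connected , max = maximal A A∈ in record
    { nonempty = nonempty A A∈ ; connected = connected ; closed = maximal⇒closed connected max }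

  forest : Forest r G P1 P1
  forest = All.map (λ cl → 1 , cluster cl , mnum-cluster cl clusters disjoint) clusters , disjoint
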